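{- For every list (sequence) of functions $f_1,f_2,f_3,\ldots:\mathbb{N}\to\mathbb{N}$ there exists a function $g:\mathbb{N}\to\mathbb{N}$ that dominates every $f_i$ ($i\geq 1$).
   Context: A function $g:\mathbb{N}\to\mathbb{N}$ is said to dominate a function $f:\mathbb{N}\to\mathbb{N}$ when the inequality $g(x)>f(x)$ holds for all but finitely many $x\in\mathbb{N}$. -}

module Defs where

open import Data.List.Membership.Propositional using (_∉_)
open import Data.Nat using (ℕ; _>_)
open import Data.Product using (∃-syntax)

-- The exceptions are required to lie in a finite set, given by a list of its elements.
AllButFinitelyMany : (ℕ → Set) → Set
AllButFinitelyMany P = ∃[ xs ] (∀ x → x ∉ xs → P x)

_dominates_ : (ℕ → ℕ) → (ℕ → ℕ) → Set
g dominates f = AllButFinitelyMany (λ x → g x > f x)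

{-# OPTIONS --safe #-}
-- Diagonalise: let g x exceed the values at x of the first x functions, so that
-- g x > f i x can fail only when x < i.
module Submission where

open import Defs
open import Data.List using (map; upTo)
open import Data.List.Extrema.Nat using (max; xs≤max)
open import Data.List.Membership.Propositional.Properties using (∈-map⁺; ∈-upTo⁺)
import Data.List.Relation.Unary.All as All
open import Data.Nat using (ℕ; suc; _≤_; s≤s; NonZero)
open import Data.Nat.Properties using (≮⇒≥)
open import Data.Product using (Σ-syntax; _,_)
open import Function using (_∘_)

-- Each point constrains g by finitely many functions only, so a maximum exists there, yet every
-- function is eventually among them.

theorem5p1 : (f : (i : ℕ) → .{{NonZero i}} → ℕ → ℕ) →
    Σ[ g ∈ (ℕ → ℕ) ] (∀ i → .{{_ : NonZero i}} → g dominates (f i))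
theorem5p1 f = suc ∘ bound , dominated
  where
  -- The shift makes `upTo x`, that is 0, ..., x - 1, index the functions 1, ..., x, and `suc k` is
  -- visibly nonzero.
  values : ℕ → ℕ → ℕ
  values x k = f (suc k) x

  bound : ℕ → ℕ
  -- The default 0 is the value at x = 0, where the list is empty.
  bound x = max 0 (map (values x) (upTo x))

  ≤bound : ∀ {k x} → suc k ≤ x → f (suc k) x ≤ bound x
  ≤bound {x = x} k<x = All.lookup (xs≤max 0 _) (∈-map⁺ (values x) (∈-upTo⁺ k<x))

  dominated : ∀ i → .{{_ : NonZero i}} → (suc ∘ bound) dominates (f i)
  -- Outside the exceptions 0, ..., k, `suc k ≤ x` holds, so `f (suc k) x` is under the maximum; the
  -- outer `suc` makes the inequality strict.
  dominated (suc k) = upTo (suc k) , λ x x∉ → s≤s (≤bound (≮⇒≥ (x∉ ∘ ∈-upTo⁺)))
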